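{- Let $w\in\mathfrak{S}_n$. The following are equivalent: (i) $w$ avoids the patterns $4231$, $35142$, $42513$ and $351624$; (ii) $\ell'(uw^{ -1})=a\ell(u,w)$ for all $u<w$ in the Bruhat order.
   Context: $\mathfrak{S}_n$ is the Coxeter group with generators the adjacent transpositions; $T$ is the set of all transpositions; $\ell$ is Coxeter length; permutations act on the right on $[n]$ and $uw$ means "first $u$, then $w$". The absolute length $\ell'(v)$ is the smallest number of transpositions whose product is $v$. The Bruhat graph is the directed graph on $\mathfrak{S}_n$ with an edge $x\to tx$ whenever $t\in T$ and $\ell(x)<\ell(tx)$; for $u\le w$, $a\ell(u,w)$ is the length of a shortest directed path from $u$ to $w$ in it. Pattern avoidance: for $p\in\mathfrak{S}_m$ in one-line notation, $w$ avoids $p$ if there are no $i_1<\cdots<i_m$ with $i_aw<i_bw\iff ap<bp$ for all $a,b$. -}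

module Defs where

open import Data.Nat using (ℕ; zero; suc; _≤_; _<_)
open import Data.Fin using (Fin; toℕ)
import Data.Fin as F
open import Data.Fin.Permutation public
  using (Permutation′; _⟨$⟩ʳ_; _≈_; id; flip; _∘ₚ_; transpose)
open import Data.List using (List; []; _∷_; length; filter; allFin; cartesianProduct; foldr)
open import Data.Vec using (Vec; lookup; []; _∷_)
open import Data.Product using (Σ; _×_; _,_; ∃; ∃-syntax)
open import Relation.Nullary using (¬_)
open import Relation.Nullary.Decidable using (_×-dec_)
open import Relation.Binary.PropositionalEquality using (_≡_; _≢_)
open import Function.Bundles using (_⇔_)

-- Elements of 𝔖_n: permutations of [n] = Fin n (0-based).
-- They act on the RIGHT: "i w" is  w ⟨$⟩ʳ i.
Perm : ℕ → Set
Perm n = Permutation′ n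

-- Product uw = "first u, then w".  With stdlib, u ∘ₚ w applies u first.
_·_ : ∀ {n} → Perm n → Perm n → Perm n
u · w = u ∘ₚ w

infixl 7 _·_

_⁻¹ : ∀ {n} → Perm n → Perm n
w ⁻¹ = flip w

-- Coxeter length (w.r.t. adjacent transpositions) = number of inversions
-- of the one-line notation (1w, ..., nw): pairs i < j with i w > j w.
ℓ : ∀ {n} → Perm n → ℕ
ℓ {n} w = length (filter (λ p → (Data.Product.proj₁ p F.<? Data.Product.proj₂ p)
                                 ×-dec ((w ⟨$⟩ʳ Data.Product.proj₂ p) F.<? (w ⟨$⟩ʳ Data.Product.proj₁ p)))
                         (cartesianProduct (allFin n) (allFin n)))

IsTransposition : ∀ {n} → Perm n → Set
IsTransposition {n} t = Σ (Fin n) λ i → Σ (Fin n) λ j → i ≢ j × t ≈ transpose i j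

prod : ∀ {n} → List (Perm n) → Perm n
prod = foldr _·_ id

data AllTrans {n : ℕ} : List (Perm n) → Set where
  []  : AllTrans []
  _∷_ : ∀ {t ts} → IsTransposition t → AllTrans ts → AllTrans (t ∷ ts)

ProdOfTrans : ∀ {n} → Perm n → ℕ → Set
ProdOfTrans {n} v k = Σ (List (Perm n)) λ ts → AllTrans ts × length ts ≡ k × prod ts ≈ v

AbsLength : ∀ {n} → Perm n → ℕ → Set
AbsLength v k = ProdOfTrans v k × (∀ m → ProdOfTrans v m → k ≤ m)

BruhatEdge : ∀ {n} → Perm n → Perm n → Set
BruhatEdge {n} x y = Σ (Perm n) λ t → IsTransposition t × y ≈ t · x × ℓ x < ℓ y

data Path {n : ℕ} : Perm n → Perm n → ℕ → Set where
  stop : ∀ {x y} → x ≈ y → Path x y 0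
  step : ∀ {x y z k} → BruhatEdge x y → Path y z k → Path x z (suc k)

_≤B_ : ∀ {n} → Perm n → Perm n → Set
u ≤B w = ∃[ k ] Path u w k

_<B_ : ∀ {n} → Perm n → Perm n → Set
u <B w = u ≤B w × ¬ (u ≈ w)

AbsLengthPath : ∀ {n} → Perm n → Perm n → ℕ → Set
AbsLengthPath u w k = Path u w k × (∀ m → Path u w m → k ≤ m)

-- Pattern avoidance.  A pattern p ∈ 𝔖_m is given by its one-line notation
-- (1-based values, e.g. 4231 as 4 ∷ 2 ∷ 3 ∷ 1 ∷ []).
-- An occurrence: i₁ < ... < i_m (a strictly increasing ι : Fin m → Fin n)
-- with  i_a w < i_b w  ⇔  a p < b p  for all a, b.
Occurs : ∀ {m n} → Vec ℕ m → Perm n → Set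
Occurs {m} {n} p w =
  Σ (Fin m → Fin n) λ ι →
    (∀ a b → a F.< b → ι a F.< ι b) ×
    (∀ a b → ((w ⟨$⟩ʳ ι a) F.< (w ⟨$⟩ʳ ι b)) ⇔ (lookup p a < lookup p b))

Avoids : ∀ {m n} → Perm n → Vec ℕ m → Set
Avoids w p = ¬ Occurs p w

p4231 : Vec ℕ 4
p4231 = 4 ∷ 2 ∷ 3 ∷ 1 ∷ []

p35142 : Vec ℕ 5
p35142 = 3 ∷ 5 ∷ 1 ∷ 4 ∷ 2 ∷ []

p42513 : Vec ℕ 5
p42513 = 4 ∷ 2 ∷ 5 ∷ 1 ∷ 3 ∷ []

p351624 : Vec ℕ 6
p351624 = 3 ∷ 5 ∷ 1 ∷ 6 ∷ 2 ∷ 4 ∷ []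

{-# OPTIONS --safe #-}

-- Record a permutation x by its points (i , x i), rows downwards and columns to the right.
-- The hull of w consists of the cells having a point of w weakly to the north-east and one
-- weakly to the south-west; going down in the Bruhat graph from w never leaves it.  Multiplying
-- u by the transposition of two rows consecutive in a cycle of u w⁻¹ lowers the absolute length
-- by one, so (i) ⇒ (ii) follows once every u ≢ w in the hull admits such a multiplication that
-- goes up and stays inside the hull.  If u admits none, then at a cell where a cycle, drawn as a
-- closed rook path through the points of u and w, turns at its north-west end, avoidance of the
-- patterns allows this turn to be cut off, and what remains is still a permutation of this kind
-- with more rows on which it agrees with w: an infinite descent.
-- For (ii) ⇒ (i), each pattern comes with some u < w rearranging only its rows such that u w⁻¹
-- exchanges two of them.  A path of length ℓ'(u w⁻¹) can only transpose rows lying in a common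
-- cycle, hence the remaining rows of u would have to lie below those of w by themselves, which
-- fails.

module Submission where

open import Defs
open import Data.Empty using (⊥; ⊥-elim)
open import Data.Fin using (Fin; suc; toℕ; #_)
import Data.Fin as F
import Data.Fin.Induction as FinInd
import Data.Fin.Permutation.Components as PC
open import Data.Fin.Permutation using (_⟨$⟩ˡ_; inverseˡ; inverseʳ)
open import Data.Fin.Properties using (_≟_; <-cmp; <⇒≢; ≤∧≢⇒<; any?; all?)
open import Data.List using (List; []; _∷_; _++_; length; filter; map; allFin)
open import Data.List.Membership.Propositional using (_∈_)
open import Data.List.Membership.Propositional.Properties
  using (∈-∃++; ∈-++⁻; ∈-++⁺ˡ; ∈-++⁺ʳ; ∈-map⁻; ∈-filter⁺; ∈-filter⁻; ∈-allFin; ∈-cartesianProduct⁺)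
open import Data.List.Properties using (length-++; length-map)
import Data.List.Relation.Unary.All as All
open import Data.List.Relation.Unary.AllPairs using ([]; _∷_)
open import Data.List.Relation.Unary.Any using (here; there)
open import Data.List.Relation.Unary.Unique.Propositional using (Unique)
import Data.List.Relation.Unary.Unique.Propositional.Properties as Unique
open import Data.Nat using (ℕ; suc; _+_; z≤n; s≤s; _≤_; _<_; _<?_)
open import Data.Nat.Induction using (Acc; acc; <-wellFounded)
open import Data.Nat.Properties as ℕ
  using (≤-refl; ≤-trans; <-trans; <-≤-trans; ≤-<-trans; <-irrefl; <⇒≤; ≮⇒≥; ≰⇒>)
open import Data.Product using (_×_; _,_; ∃-syntax; proj₁; proj₂)
open import Data.Sum using (_⊎_; inj₁; inj₂; [_,_]′)
open import Data.Unit using (⊤; tt)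
open import Data.Vec as Vec using (Vec; []; _∷_; lookup)
open import Data.Vec.Properties using (lookup-map)
open import Data.Vec.Relation.Unary.Linked using (Linked; [-]; _∷_)
import Data.Vec.Relation.Unary.Linked.Properties as Linked
open import Function using (_∘_; _⇔_; mk⇔; Equivalence)
open import Relation.Binary.Definitions using (tri<; tri≈; tri>)
open import Relation.Binary.PropositionalEquality
  using (_≡_; _≢_; refl; sym; trans; cong; cong₂; subst; subst₂; module ≡-Reasoning)
open import Relation.Nullary using (¬_; Dec; yes; no)
open import Relation.Nullary.Decidable
  using (_×-dec_; _⊎-dec_; _→-dec_; ¬?; decidable-stable; True; toWitness)
open import Relation.Unary using (Decidable)

private
  variable
    n : ℕ

-- Counting

unique-⊆⇒length≤ : ∀ {A : Set} {xs ys : List A} → Unique xs →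
                   (∀ {x} → x ∈ xs → x ∈ ys) → length xs ≤ length ys
unique-⊆⇒length≤ [] sub = z≤n
unique-⊆⇒length≤ {xs = x ∷ xs} (x∉ ∷ uniq) sub with ∈-∃++ (sub (here refl))
... | ls , rs , refl = begin
    suc (length xs)              ≤⟨ s≤s (unique-⊆⇒length≤ uniq sub′) ⟩
    suc (length (ls ++ rs))      ≡⟨ cong suc (length-++ ls) ⟩
    suc (length ls + length rs)  ≡⟨ sym (ℕ.+-suc (length ls) (length rs)) ⟩
    length ls + suc (length rs)  ≡⟨ sym (length-++ ls) ⟩
    length (ls ++ x ∷ rs)        ∎
  where
  open ℕ.≤-Reasoning
  sub′ : ∀ {y} → y ∈ xs → y ∈ ls ++ rs
  sub′ y∈ with ∈-++⁻ ls (sub (there y∈))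
  ... | inj₁ y∈ls = ∈-++⁺ˡ y∈ls
  ... | inj₂ (there y∈rs) = ∈-++⁺ʳ ls y∈rs
  ... | inj₂ (here refl) = ⊥-elim (All.lookup x∉ y∈ refl)

-- The images of the elements satisfying `P`, together with the missed element `a`, form a list
-- without repetitions inside the filtered list for `Q`.
length-filter-< : ∀ {A : Set} {P Q : A → Set} (P? : Decidable P) (Q? : Decidable Q) {xs} →
  Unique xs → (∀ x → x ∈ xs) → (φ : A → A) → (∀ {x y} → φ x ≡ φ y → x ≡ y) →
  (∀ {x} → P x → Q (φ x)) → ∀ a → Q a → (∀ {x} → P x → φ x ≢ a) →
  length (filter P? xs) < length (filter Q? xs)
length-filter-< P? Q? {xs} uniq full φ φ-inj φ-PQ a Qa a∉ =
  subst (λ k → suc k ≤ length (filter Q? xs)) (length-map φ (filter P? xs))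
    (unique-⊆⇒length≤
      (All.tabulate (λ y∈ a≡y → fresh y∈ (sym a≡y)) ∷ Unique.map⁺ φ-inj (Unique.filter⁺ P? uniq))
      sub)
  where
  fresh : ∀ {y} → y ∈ map φ (filter P? xs) → y ≢ a
  fresh y∈ y≡a with ∈-map⁻ φ y∈
  ... | x , x∈ , refl = a∉ (proj₂ (∈-filter⁻ P? {xs = xs} x∈)) y≡a
  sub : ∀ {y} → y ∈ a ∷ map φ (filter P? xs) → y ∈ filter Q? xs
  sub (here refl) = ∈-filter⁺ Q? (full a) Qa
  sub (there y∈) with ∈-map⁻ φ y∈
  ... | x , x∈ , refl = ∈-filter⁺ Q? (full (φ x)) (φ-PQ (proj₂ (∈-filter⁻ P? {xs = xs} x∈)))

-- Transpositions

swap : Fin n → Fin n → Fin n → Fin n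
swap = PC.transpose

swapˡ : (i j : Fin n) → swap i j i ≡ j
swapˡ i j with i ≟ i
... | yes _ = refl
... | no i≢i = ⊥-elim (i≢i refl)

swapʳ : (i j : Fin n) → swap i j j ≡ i
swapʳ i j with j ≟ i
... | yes j≡i = j≡i
... | no _ with j ≟ j
...   | yes _ = refl
...   | no j≢j = ⊥-elim (j≢j refl)

swap-≢ : {i j k : Fin n} → k ≢ i → k ≢ j → swap i j k ≡ k
swap-≢ {i = i} {j} {k} k≢i k≢j with k ≟ i
... | yes k≡i = ⊥-elim (k≢i k≡i)
... | no _ with k ≟ j
...   | yes k≡j = ⊥-elim (k≢j k≡j)
...   | no _ = refl

data SwapView (i j k : Fin n) : Set where
  at-left  : k ≡ i → swap i j k ≡ j → SwapView i j k
  at-right : k ≡ j → swap i j k ≡ i → SwapView i j k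
  outside  : k ≢ i → k ≢ j → swap i j k ≡ k → SwapView i j k

swapView : (i j k : Fin n) → SwapView i j k
swapView i j k with k ≟ i
... | yes refl = at-left refl (swapˡ i j)
... | no k≢i with k ≟ j
...   | yes refl = at-right refl (swapʳ i j)
...   | no k≢j = outside k≢i k≢j (swap-≢ k≢i k≢j)

swap-comm : (i j k : Fin n) → swap i j k ≡ swap j i k
swap-comm i j k with swapView i j k
... | at-left refl eq = trans eq (sym (swapʳ j i))
... | at-right refl eq = trans eq (sym (swapˡ j i))
... | outside k≢i k≢j eq = trans eq (sym (swap-≢ k≢j k≢i))

swap-involutive : (i j k : Fin n) → swap i j (swap i j k) ≡ k
swap-involutive i j k = trans (swap-comm i j (swap i j k)) (PC.transpose-inverse j i)

swap-injective : (i j : Fin n) → ∀ {k l} → swap i j k ≡ swap i j l → k ≡ l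
swap-injective i j {k} {l} eq =
  trans (sym (swap-involutive i j k)) (trans (cong (swap i j) eq) (swap-involutive i j l))

swap-conj : ∀ {m} (f : Fin m → Fin n) → (∀ {k l} → f k ≡ f l → k ≡ l) →
            ∀ a b p → f (swap a b p) ≡ swap (f a) (f b) (f p)
swap-conj f f-inj a b p with swapView a b p
... | at-left refl eq = trans (cong f eq) (sym (swapˡ (f a) (f b)))
... | at-right refl eq = trans (cong f eq) (sym (swapʳ (f a) (f b)))
... | outside p≢a p≢b eq =
  trans (cong f eq) (sym (swap-≢ (λ e → p≢a (f-inj e)) (λ e → p≢b (f-inj e))))

perm-injective : (x : Perm n) → ∀ {i j} → x ⟨$⟩ʳ i ≡ x ⟨$⟩ʳ j → i ≡ j
perm-injective x {i} {j} eq =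
  trans (sym (inverseˡ x)) (trans (cong (x ⟨$⟩ˡ_) eq) (inverseˡ x))

-- Length and the edges of the Bruhat graph

IsInversion : Perm n → Fin n × Fin n → Set
IsInversion x (p , q) = p F.< q × (x ⟨$⟩ʳ q) F.< (x ⟨$⟩ʳ p)

isInversion? : (x : Perm n) → Decidable (IsInversion x)
isInversion? x (p , q) = (p F.<? q) ×-dec ((x ⟨$⟩ʳ q) F.<? (x ⟨$⟩ʳ p))

module _ {n} (x y : Perm n) (i j : Fin n) (i<j : i F.< j)
         (y≈ : y ≈ transpose i j · x) (up : (x ⟨$⟩ʳ i) F.< (x ⟨$⟩ʳ j)) where
  private
    τ : Fin n → Fin n
    τ = swap i j

    moved? : (p q : Fin n) → Dec (p F.< q × τ p F.< τ q)
    moved? p q = (p F.<? q) ×-dec (τ p F.<? τ q)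

    φ : Fin n × Fin n → Fin n × Fin n
    φ (p , q) with moved? p q
    ... | yes _ = τ p , τ q
    ... | no _ = p , q

    φ-moved : ∀ {p q} → p F.< q → τ p F.< τ q → φ (p , q) ≡ (τ p , τ q)
    φ-moved {p} {q} p<q τ< with moved? p q
    ... | yes _ = refl
    ... | no ¬m = ⊥-elim (¬m (p<q , τ<))

    φ-involutive : ∀ a → φ (φ a) ≡ a
    φ-involutive (p , q) with moved? p q in eq
    ... | yes (p<q , τ<) = trans
            (φ-moved τ< (subst (λ z → z F.< τ (τ q)) (sym (swap-involutive i j p))
                          (subst (p F.<_) (sym (swap-involutive i j q)) p<q)))
            (cong₂ _,_ (swap-involutive i j p) (swap-involutive i j q))
    ... | no _ rewrite eq = refl

    φ-injective : ∀ {a b} → φ a ≡ φ b → a ≡ b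
    φ-injective {a} {b} eq = trans (sym (φ-involutive a)) (trans (cong φ eq) (φ-involutive b))

    yi : y ⟨$⟩ʳ i ≡ x ⟨$⟩ʳ j
    yi = trans (y≈ i) (cong (x ⟨$⟩ʳ_) (swapˡ i j))

    yj : y ⟨$⟩ʳ j ≡ x ⟨$⟩ʳ i
    yj = trans (y≈ j) (cong (x ⟨$⟩ʳ_) (swapʳ i j))

    yτ : ∀ p → y ⟨$⟩ʳ τ p ≡ x ⟨$⟩ʳ p
    yτ p = trans (y≈ (τ p)) (cong (x ⟨$⟩ʳ_) (swap-involutive i j p))

    y-out : ∀ {p} → p ≢ i → p ≢ j → y ⟨$⟩ʳ p ≡ x ⟨$⟩ʳ p
    y-out p≢i p≢j = trans (y≈ _) (cong (x ⟨$⟩ʳ_) (swap-≢ p≢i p≢j))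

    -- Apart from `(i , j)`, which is no inversion of `x`, a pair reversed by `τ` has `i` as its
    -- upper row or `j` as its lower row. Passing to `y` raises the value in row `i` and lowers the
    -- one in row `j`, so the inversion survives.
    stays : ∀ p q → IsInversion x (p , q) → ¬ (τ p F.< τ q) → IsInversion y (p , q)
    stays p q (p<q , xq<xp) ¬τ with swapView i j p | swapView i j q
    ... | at-left refl _ | at-left refl _ = ⊥-elim (<-irrefl refl p<q)
    ... | at-left refl _ | at-right refl _ = ⊥-elim (<-irrefl refl (<-trans up xq<xp))
    ... | at-left refl _ | outside q≢i q≢j _ =
      p<q , subst (F._< (y ⟨$⟩ʳ i)) (sym (y-out q≢i q≢j))
              (subst ((x ⟨$⟩ʳ q) F.<_) (sym yi) (<-trans xq<xp up))
    ... | at-right refl τp | at-left refl _ = ⊥-elim (<-irrefl refl (<-trans p<q i<j))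
    ... | at-right refl _ | at-right refl _ = ⊥-elim (<-irrefl refl p<q)
    ... | at-right refl τp | outside _ _ τq =
      ⊥-elim (¬τ (subst (F._< τ q) (sym τp) (subst (i F.<_) (sym τq) (<-trans i<j p<q))))
    ... | outside _ _ τp | at-left refl τq =
      ⊥-elim (¬τ (subst (F._< τ q) (sym τp) (subst (p F.<_) (sym τq) (<-trans p<q i<j))))
    ... | outside p≢i p≢j _ | at-right refl _ =
      p<q , subst (F._< (y ⟨$⟩ʳ p)) (sym yj)
              (subst ((x ⟨$⟩ʳ i) F.<_) (sym (y-out p≢i p≢j)) (<-trans up xq<xp))
    ... | outside _ _ τp | outside _ _ τq =
      ⊥-elim (¬τ (subst (F._< τ q) (sym τp) (subst (p F.<_) (sym τq) p<q)))

    φ-inversion : ∀ {a} → IsInversion x a → IsInversion y (φ a)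
    φ-inversion {p , q} inv@(p<q , xq<xp) with moved? p q
    ... | yes (_ , τ<) = τ< , subst (F._< (y ⟨$⟩ʳ τ p)) (sym (yτ q))
                                (subst ((x ⟨$⟩ʳ q) F.<_) (sym (yτ p)) xq<xp)
    ... | no ¬m = stays p q inv (λ τ< → ¬m (p<q , τ<))

    φ-misses : ∀ {a} → IsInversion x a → φ a ≢ (i , j)
    φ-misses {a} inv eq = <-irrefl refl (<-trans up
      (proj₂ (subst (IsInversion x) (trans (sym (φ-involutive a)) (trans (cong φ eq) φ-ij)) inv)))
      where
      φ-ij : φ (i , j) ≡ (i , j)
      φ-ij with moved? i j
      ... | no _ = refl
      ... | yes (_ , τ<) = ⊥-elim (<-irrefl refl (<-trans i<j
              (subst (F._< i) (swapˡ i j) (subst (τ i F.<_) (swapʳ i j) τ<))))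

  -- Conjugation by (i j) injects the inversions of x into those of y, except that
  -- pairs whose order it would reverse are kept; the pair (i , j) itself is missed.
  ℓ-up : ℓ x < ℓ y
  ℓ-up = length-filter-< (isInversion? x) (isInversion? y)
    (Unique.cartesianProduct⁺ (Unique.allFin⁺ n) (Unique.allFin⁺ n))
    (λ (p , q) → ∈-cartesianProduct⁺ (∈-allFin p) (∈-allFin q))
    φ φ-injective φ-inversion
    (i , j) (i<j , subst (F._< (y ⟨$⟩ʳ i)) (sym yj) (subst ((x ⟨$⟩ʳ i) F.<_) (sym yi) up))
    φ-misses

record Ascent {n} (x y : Perm n) : Set where
  constructor ascent
  field
    {lo hi} : Fin n
    lo<hi : lo F.< hi
    up    : (x ⟨$⟩ʳ lo) F.< (x ⟨$⟩ʳ hi)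
    y≈    : y ≈ transpose lo hi · x

ascent⇒edge : {x y : Perm n} → Ascent x y → BruhatEdge x y
ascent⇒edge {x = x} {y} (ascent {i} {j} i<j up y≈) =
  transpose i j , (i , j , <⇒≢ i<j , λ _ → refl) , y≈ , ℓ-up x y i j i<j y≈ up

-- If the values descended, the same transposition would be an ascent from `y` to `x`, and `ℓ-up`
-- would contradict the growth of the length.
edge⇒ascent : {x y : Perm n} → BruhatEdge x y → Ascent x y
edge⇒ascent {x = x} {y} (t , (i , j , i≢j , t≈) , y≈ , ℓ<) = ordered (<-cmp i j)
  where
  y≈swap : y ≈ transpose i j · x
  y≈swap p = trans (y≈ p) (cong (x ⟨$⟩ʳ_) (t≈ p))

  sorted : ∀ {i j} → i F.< j → y ≈ transpose i j · x → Ascent x y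
  sorted {i} {j} i<j y≈ with <-cmp (x ⟨$⟩ʳ i) (x ⟨$⟩ʳ j)
  ... | tri< up _ _ = ascent i<j up y≈
  ... | tri≈ _ eq _ = ⊥-elim (<⇒≢ i<j (perm-injective x eq))
  ... | tri> _ _ down = ⊥-elim (<-irrefl refl (<-trans ℓ<
          (ℓ-up y x i j i<j (λ p → trans (cong (x ⟨$⟩ʳ_) (sym (swap-involutive i j p))) (sym (y≈ (swap i j p))))
            (subst (F._< (y ⟨$⟩ʳ j)) (sym (trans (y≈ i) (cong (x ⟨$⟩ʳ_) (swapˡ i j))))
              (subst ((x ⟨$⟩ʳ j) F.<_) (sym (trans (y≈ j) (cong (x ⟨$⟩ʳ_) (swapʳ i j)))) down)))))

  ordered : _ → Ascent x y
  ordered (tri< i<j _ _) = sorted i<j y≈swap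
  ordered (tri≈ _ i≡j _) = ⊥-elim (i≢j i≡j)
  ordered (tri> _ _ j<i) =
    sorted j<i (λ p → trans (y≈swap p) (cong (x ⟨$⟩ʳ_) (swap-comm i j p)))

-- Products of transpositions

transpose-isTransposition : {i j : Fin n} → i ≢ j → IsTransposition (transpose i j)
transpose-isTransposition {i = i} {j} i≢j = i , j , i≢j , λ _ → refl

prodOfTrans-≈ : {v v′ : Perm n} {k : ℕ} → v ≈ v′ → ProdOfTrans v k → ProdOfTrans v′ k
prodOfTrans-≈ v≈ (ts , all , len , eq) = ts , all , len , λ p → trans (eq p) (v≈ p)

prodOfTrans-cons : {v v′ : Perm n} {k : ℕ} {i j : Fin n} → i ≢ j →
                   (∀ p → v′ ⟨$⟩ʳ p ≡ v ⟨$⟩ʳ swap i j p) → ProdOfTrans v k → ProdOfTrans v′ (suc k)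
prodOfTrans-cons {i = i} {j} i≢j v′≈ (ts , all , len , eq) =
  transpose i j ∷ ts , transpose-isTransposition i≢j ∷ all , cong suc len ,
  λ p → trans (eq (swap i j p)) (sym (v′≈ p))

-- Cutting `j` out of its cycle saves one factor in any factorization, shortest or not. The orbit of
-- `i` is followed through the factors: those fixing it are conjugated by `(i j)`, and the one
-- carrying it to `j` is dropped.
bypass-list : ∀ {ts : List (Perm n)} → AllTrans ts → ∀ {i j} → i ≢ j → prod ts ⟨$⟩ʳ i ≡ j →
  ∃[ ts′ ] AllTrans ts′ × suc (length ts′) ≡ length ts
         × (∀ p → prod ts′ ⟨$⟩ʳ p ≡ prod ts ⟨$⟩ʳ swap i j p)
bypass-list [] i≢j i≡j = ⊥-elim (i≢j i≡j)
bypass-list {n} {ts = t ∷ ts} ((a , b , a≢b , t≈) ∷ all) {i} {j} i≢j vi≡j with t ⟨$⟩ʳ i ≟ i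
... | yes ti≡i with bypass-list all i≢j (trans (cong (prod ts ⟨$⟩ʳ_) (sym ti≡i)) vi≡j)
...   | ts′ , all′ , len , eq =
  transpose (τ a) (τ b) ∷ ts′ ,
  transpose-isTransposition (λ e → a≢b (swap-injective i j e)) ∷ all′ , cong suc len , λ p → begin
    prod ts′ ⟨$⟩ʳ swap (τ a) (τ b) p              ≡⟨ eq _ ⟩
    prod ts ⟨$⟩ʳ τ (swap (τ a) (τ b) p)
      ≡⟨ cong (prod ts ⟨$⟩ʳ_) (swap-conj τ (swap-injective i j) (τ a) (τ b) p) ⟩
    prod ts ⟨$⟩ʳ swap (τ (τ a)) (τ (τ b)) (τ p)   ≡⟨ cong (prod ts ⟨$⟩ʳ_)
              (cong₂ (λ a b → swap a b (τ p)) (swap-involutive i j a) (swap-involutive i j b)) ⟩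
    prod ts ⟨$⟩ʳ swap a b (τ p)                   ≡⟨ cong (prod ts ⟨$⟩ʳ_) (sym (t≈ (τ p))) ⟩
    prod ts ⟨$⟩ʳ (t ⟨$⟩ʳ τ p)                     ∎
  where
  open ≡-Reasoning
  τ = swap i j
bypass-list {n} {ts = t ∷ ts} ((a , b , a≢b , t≈) ∷ all) {i} {j} i≢j vi≡j | no ti≢i = go (s ≟ j)
  where
  open ≡-Reasoning
  s = t ⟨$⟩ʳ i

  t≈is : ∀ p → t ⟨$⟩ʳ p ≡ swap i s p
  t≈is with swapView a b i
  ... | at-left refl eq = λ p → trans (t≈ p) (cong (λ z → swap i z p) (sym (trans (t≈ i) eq)))
  ... | at-right refl eq = λ p → trans (t≈ p)
          (trans (swap-comm a i p) (cong (λ z → swap i z p) (sym (trans (t≈ i) eq))))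
  ... | outside _ _ eq = ⊥-elim (ti≢i (trans (t≈ i) eq))

  go : Dec (s ≡ j) → _
  go (yes s≡j) = ts , all , refl , λ p → cong (prod ts ⟨$⟩ʳ_) (sym (begin
    t ⟨$⟩ʳ swap i j p    ≡⟨ t≈is _ ⟩
    swap i s (swap i j p) ≡⟨ cong (λ z → swap i z (swap i j p)) s≡j ⟩
    swap i j (swap i j p) ≡⟨ swap-involutive i j p ⟩
    p                     ∎))
  -- First `(i j)`, then `(i s)` is the same as first `(i s)`, then `(s j)`; so the tail has to
  -- absorb `(s j)`.
  go (no s≢j) with bypass-list all s≢j vi≡j
  ... | ts′ , all′ , len , eq =
    transpose i s ∷ ts′ , transpose-isTransposition (λ e → ti≢i (sym e)) ∷ all′ , cong suc len ,
    λ p → begin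
      prod ts′ ⟨$⟩ʳ swap i s p                          ≡⟨ eq _ ⟩
      prod ts ⟨$⟩ʳ swap s j (swap i s p)                ≡⟨ cong (prod ts ⟨$⟩ʳ_)
              (cong₂ (λ k l → swap k l (swap i s p)) (sym (swapˡ i s))
                (sym (swap-≢ (λ e → i≢j (sym e)) (λ e → s≢j (sym e))))) ⟩
      prod ts ⟨$⟩ʳ swap (swap i s i) (swap i s j) (swap i s p)
            ≡⟨ cong (prod ts ⟨$⟩ʳ_) (sym (swap-conj (swap i s) (swap-injective i s) i j p)) ⟩
      prod ts ⟨$⟩ʳ swap i s (swap i j p)                ≡⟨ cong (prod ts ⟨$⟩ʳ_) (sym (t≈is _)) ⟩
      prod ts ⟨$⟩ʳ (t ⟨$⟩ʳ swap i j p)                  ∎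

bypass : ∀ {v : Perm n} {k i j} → i ≢ j → v ⟨$⟩ʳ i ≡ j → ProdOfTrans v k →
         ∃[ k′ ] k ≡ suc k′ × ProdOfTrans (transpose i j · v) k′
bypass {i = i} {j} i≢j vi≡j (ts , all , len , eq) with bypass-list all i≢j (trans (eq i) vi≡j)
... | ts′ , all′ , len′ , eq′ =
  length ts′ , trans (sym len) (sym len′) , ts′ , all′ , refl , λ p → trans (eq′ p) (eq (swap i j p))

-- This gives one of the two inequalities, `ℓ'` at most the path length, for every `w`.
path⇒prodOfTrans : ∀ {x w : Perm n} {k} → Path x w k → ProdOfTrans (x · w ⁻¹) k
path⇒prodOfTrans {w = w} (stop x≈w) =
  [] , [] , refl , λ p → sym (trans (cong (w ⟨$⟩ˡ_) (x≈w p)) (inverseˡ w {p}))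
path⇒prodOfTrans {x = x} {w} (step {y = y} e path) with edge⇒ascent {x = x} {y} e
... | ascent {i} {j} i<j _ y≈ = prodOfTrans-cons {v = y · w ⁻¹} {v′ = x · w ⁻¹} (<⇒≢ {i = i} {j} i<j)
  (λ p → cong (w ⟨$⟩ˡ_) (sym (trans (y≈ _) (cong (x ⟨$⟩ʳ_) (swap-involutive i j p)))))
  (path⇒prodOfTrans path)

-- The hull of a permutation

module Hull {n} (w : Perm n) where

  W : Fin n → Fin n
  W = w ⟨$⟩ʳ_

  W-injective : ∀ {i j} → W i ≡ W j → i ≡ j
  W-injective = perm-injective w

  -- The cell (i , y) lies in the hull of w when both hold: a point of w lies weakly
  -- to its north-east and another one weakly to its south-west.
  NE SW : Fin n → Fin n → Set
  NE i y = ∃[ k ] k F.≤ i × y F.≤ W k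
  SW i y = ∃[ k ] i F.≤ k × W k F.≤ y

  InHull : Perm n → Set
  InHull u = ∀ i → NE i (u ⟨$⟩ʳ i) × SW i (u ⟨$⟩ʳ i)

  NE? : ∀ i y → Dec (NE i y)
  NE? i y = any? λ k → (k F.≤? i) ×-dec (y F.≤? W k)

  SW? : ∀ i y → Dec (SW i y)
  SW? i y = any? λ k → (i F.≤? k) ×-dec (W k F.≤? y)

  NE-mono : ∀ {i i′ y y′} → i F.≤ i′ → y′ F.≤ y → NE i y → NE i′ y′
  NE-mono i≤ y≤ (k , k≤i , y≤k) = k , ≤-trans k≤i i≤ , ≤-trans y≤ y≤k

  SW-mono : ∀ {i i′ y y′} → i′ F.≤ i → y F.≤ y′ → SW i y → SW i′ y′
  SW-mono i≤ y≤ (k , i≤k , k≤y) = k , ≤-trans i≤ i≤k , ≤-trans k≤y y≤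

  -- No step i → j of the cycles of u w⁻¹ can be split off by an increasing
  -- transposition inside the hull.
  Stuck : Perm n → Set
  Stuck u = ∀ i j → u ⟨$⟩ʳ i ≡ W j →
    (i F.< j → (u ⟨$⟩ʳ i) F.< (u ⟨$⟩ʳ j) → ¬ NE i (u ⟨$⟩ʳ j)) ×
    (j F.< i → (u ⟨$⟩ʳ j) F.< (u ⟨$⟩ʳ i) → ¬ SW i (u ⟨$⟩ʳ j))

  moved : Perm n → ℕ
  moved u = length (filter (λ i → ¬? ((u ⟨$⟩ʳ i) ≟ W i)) (allFin n))

  -- Row j may take over the value u r, cutting out of its cycle the steps from j to r.
  record Redirect (u : Perm n) (j r : Fin n) : Set where
    private U = u ⟨$⟩ʳ_
    field
      cell    : NE j (U r) × SW j (U r)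
      W≢      : W j ≢ U r
      j-moved : U j ≢ W j
      r-moved : U r ≢ W r
      into    : ∀ p → U p ≡ W j → p ≢ j →
                (p F.< j → U p F.< U r → ¬ NE p (U r)) × (j F.< p → U r F.< U p → ¬ SW p (U r))
      out     : ∀ q → U r ≡ W q → q ≢ j →
                (j F.< q → U r F.< U q → ¬ NE j (U q)) × (q F.< j → U q F.< U r → ¬ SW j (U q))

  module _ (u u′ : Perm n) {j r} (red : Redirect u j r)
           (u′j : u′ ⟨$⟩ʳ j ≡ u ⟨$⟩ʳ r) (u′r : u′ ⟨$⟩ʳ r ≡ W r)
           (rest : ∀ i → i ≢ j → u′ ⟨$⟩ʳ i ≡ W i ⊎ u′ ⟨$⟩ʳ i ≡ u ⟨$⟩ʳ i) where
    open Redirect red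
    private
      U = u ⟨$⟩ʳ_
      U′ = u′ ⟨$⟩ʳ_

    redirect-inHull : InHull u → InHull u′
    redirect-inHull hull i with i ≟ j
    ... | yes refl rewrite u′j = cell
    ... | no i≢j with rest i i≢j
    ...   | inj₁ eq rewrite eq = (i , ≤-refl , ≤-refl) , (i , ≤-refl , ≤-refl)
    ...   | inj₂ eq rewrite eq = hull i

    -- The only new cycle steps are the one into `j` and the one out of `j`, and `into` and `out`
    -- are the stuck conditions for these. A fixed row is joined only to itself, and the remaining
    -- steps are steps of `u`.
    redirect-stuck : Stuck u → Stuck u′
    redirect-stuck stuck i q eq with i ≟ j | q ≟ j
    ... | yes refl | yes refl = ⊥-elim (W≢ (trans (sym eq) u′j))
    ... | yes refl | no q≢j with rest q q≢j
    ...   | inj₁ fix = ⊥-elim (q≢j (perm-injective u′ (trans fix (sym eq))))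
    ...   | inj₂ same rewrite u′j | same = out q eq q≢j
    redirect-stuck stuck i q eq | no i≢j | q≟j with rest i i≢j
    ... | inj₁ fix with W-injective (trans (sym fix) eq)
    ...   | refl = (λ i<i → ⊥-elim (<-irrefl refl i<i)) , (λ i<i → ⊥-elim (<-irrefl refl i<i))
    redirect-stuck stuck i q eq | no i≢j | yes refl | inj₂ same rewrite u′j | same = into i eq i≢j
    redirect-stuck stuck i q eq | no i≢j | no q≢j | inj₂ same with rest q q≢j
    ... | inj₁ fix with perm-injective u′ (trans fix (sym eq))
    ...   | refl = (λ i<i → ⊥-elim (<-irrefl refl i<i)) , (λ i<i → ⊥-elim (<-irrefl refl i<i))
    redirect-stuck stuck i q eq | no i≢j | no q≢j | inj₂ same | inj₂ same′
      rewrite same | same′ = stuck i q eq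

    redirect-moved : moved u′ < moved u
    redirect-moved = length-filter-< _ _ (Unique.allFin⁺ n) ∈-allFin (λ i → i) (λ eq → eq)
      moved-before r r-moved (λ { moved′ refl → moved′ u′r })
      where
      moved-before : ∀ {i} → U′ i ≢ W i → U i ≢ W i
      moved-before {i} moved′ with i ≟ j
      ... | yes refl = j-moved
      ... | no i≢j with rest i i≢j
      ...   | inj₁ fix = ⊥-elim (moved′ fix)
      ...   | inj₂ same = λ fix → moved′ (trans same fix)

    redirect-j-moved : U′ j ≢ W j
    redirect-j-moved fix = W≢ (trans (sym fix) u′j)

  -- The common content of the four forbidden patterns: two cells (r , W r₀) and (s , W s₀)
  -- spanning a rectangle inside the hull, the first with the points of w in its row and
  -- column weakly west and north of it, the second with those weakly east and south.
  NoRectangle : Set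
  NoRectangle = ∀ r r₀ s s₀ → r₀ F.≤ r → W r F.≤ W r₀ → s F.≤ s₀ → W s₀ F.≤ W s →
    r F.< s → W r₀ F.< W s₀ → NE r (W s₀) → SW s (W r₀) → ⊥

  -- Cutting off a turn of a cycle

  module _ (noRect : NoRectangle) where

    -- Rows `s` and `s₀` violating the two alternatives would yield the second cell of a forbidden
    -- rectangle: one of their two points of `w`, or the cell `(s , W s₀)` when the point of `s₀` is
    -- weakly south-west of that of `s`.
    rectangle-dichotomy : ∀ {r r₀} → r₀ F.≤ r → W r F.≤ W r₀ →
      (∀ s → r F.< s → SW s (W r₀) → W s F.≤ W r₀) ⊎
      (∀ s → W r₀ F.< W s → NE r (W s) → s F.< r)
    rectangle-dichotomy {r} {r₀} r₀≤r Wr≤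
      with all? (λ s → (r F.<? s) →-dec (SW? s (W r₀) →-dec (W s F.≤? W r₀)))
    ... | yes south = inj₁ south
    ... | no ¬south = inj₂ east
      where
      east : ∀ s₀ → W r₀ F.< W s₀ → NE r (W s₀) → s₀ F.< r
      east s₀ x<s₀ ne with <-cmp s₀ r
      ... | tri< s₀<r _ _ = s₀<r
      ... | tri≈ _ refl _ = ⊥-elim (<-irrefl refl (≤-<-trans Wr≤ x<s₀))
      ... | tri> _ _ r<s₀ = ⊥-elim (¬south south)
        where
        south : ∀ s → r F.< s → SW s (W r₀) → W s F.≤ W r₀
        south s r<s sw with W s F.≤? W r₀
        ... | yes le = le
        ... | no ¬le with W s F.<? W s₀
        ...   | yes s<s₀ = ⊥-elim (noRect r r₀ s s r₀≤r Wr≤ ≤-refl ≤-refl r<s (≰⇒> ¬le)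
                             (NE-mono ≤-refl (<⇒≤ s<s₀) ne) sw)
        ...   | no ¬s<s₀ with s F.≤? s₀
        ...     | yes s≤s₀ = ⊥-elim (noRect r r₀ s s₀ r₀≤r Wr≤ s≤s₀ (≮⇒≥ ¬s<s₀) r<s x<s₀ ne sw)
        ...     | no s≰s₀ = ⊥-elim (noRect r r₀ s₀ s₀ r₀≤r Wr≤ ≤-refl ≤-refl r<s₀ x<s₀ ne
                              (SW-mono (<⇒≤ (≰⇒> s≰s₀)) ≤-refl sw))

    module _ (u : Perm n) (hull : InHull u) (stuck : Stuck u) where
      private U = u ⟨$⟩ʳ_

      -- The turn up column `W r₀` from row `j` to row `r` and then right to column `U r` is
      -- replaced by the single cell `(j , U r)`. A move newly possible at that cell would give a
      -- move of `u`, which is stuck, or a point of `w` excluded by the dichotomy at the corner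
      -- `(r , W r₀)`.
      corner-redirect : ∀ {j r r₀} → r₀ F.≤ r → W r F.≤ W r₀ → r F.< j → U j ≡ W r₀ → W r₀ F.< U r →
                        Redirect u j r
      corner-redirect {j} {r} {r₀} r₀≤r Wr≤ r<j Uj≡ x<t = record
        { cell    = NE-mono (<⇒≤ r<j) ≤-refl (proj₁ (hull r)) , SW-mono ≤-refl (<⇒≤ x<t) swj
        ; W≢      = λ eq → proj₁ (proj₂ both) eq
        ; j-moved = λ eq → r₀≢j (W-injective (trans (sym Uj≡) eq))
        ; r-moved = λ eq → <-irrefl (cong toℕ (sym eq)) (≤-<-trans Wr≤ x<t)
        ; into    = proj₁ both
        ; out     = proj₂ (proj₂ both)
        }
        where
        swj : SW j (W r₀)
        swj = subst (SW j) Uj≡ (proj₂ (hull j))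

        r₀≢j : r₀ ≢ j
        r₀≢j = <⇒≢ (≤-<-trans r₀≤r r<j)

        Wj≢x : W j ≢ W r₀
        Wj≢x eq = r₀≢j (sym (W-injective eq))

        Into Out : Set
        Into = ∀ p → U p ≡ W j → p ≢ j →
               (p F.< j → U p F.< U r → ¬ NE p (U r)) × (j F.< p → U r F.< U p → ¬ SW p (U r))
        Out = ∀ q → U r ≡ W q → q ≢ j →
              (j F.< q → U r F.< U q → ¬ NE j (U q)) × (q F.< j → U q F.< U r → ¬ SW j (U q))

        west : W j F.< W r₀ → Into
        west Wj<x p Up≡ _ =
          (λ p<j _ ne → proj₁ (stuck p j Up≡) p<j
            (subst (U p F.<_) (sym Uj≡) (subst (F._< W r₀) (sym Up≡) Wj<x))
            (subst (NE p) (sym Uj≡) (NE-mono ≤-refl (<⇒≤ x<t) ne))) ,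
          (λ _ t<Up _ → <-irrefl refl (<-trans (subst (U r F.<_) Up≡ t<Up) (<-trans Wj<x x<t)))

        both : Into × W j ≢ U r × Out
        both with rectangle-dichotomy r₀≤r Wr≤
        ... | inj₁ south = west Wj<x , (λ eq → <-irrefl (cong toℕ eq) (<-trans Wj<x x<t)) , out′
          where
          Wj<x : W j F.< W r₀
          Wj<x = ≤∧≢⇒< (south j r<j swj) Wj≢x

          out′ : Out
          out′ q t≡ q≢j = right , left
            where
            right : j F.< q → U r F.< U q → ¬ NE j (U q)
            -- If `k` is at or above row `r`, it permits the step from `r` to `q` in `u`; if below,
            -- `south` keeps its point too far west to be a witness.
            right j<q t<Uq (k , k≤j , Uq≤) with k F.≤? r
            ... | yes k≤r = proj₁ (stuck r q t≡) (<-trans r<j j<q) t<Uq (k , k≤r , Uq≤)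
            ... | no k≰r = <-irrefl refl (<-≤-trans (<-trans x<t t<Uq)
                    (≤-trans Uq≤ (south k (≰⇒> k≰r) (SW-mono k≤j ≤-refl swj))))
            left : q F.< j → U q F.< U r → ¬ SW j (U q)
            left q<j Uq<t sw with <-cmp q r
            ... | tri< q<r _ _ = proj₂ (stuck r q t≡) q<r Uq<t (SW-mono (<⇒≤ r<j) ≤-refl sw)
            ... | tri≈ _ refl _ = <-irrefl (cong toℕ (sym t≡)) (≤-<-trans Wr≤ x<t)
            ... | tri> _ _ r<q = <-irrefl (cong toℕ (sym t≡))
                    (≤-<-trans (south q r<q (SW-mono (<⇒≤ q<j) ≤-refl swj)) x<t)
        ... | inj₂ east = into′ , W≢t , out′
          where
          W≢t : W j ≢ U r
          W≢t eq = <-irrefl refl (<-trans r<j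
            (east j (subst (W r₀ F.<_) (sym eq) x<t) (subst (NE r) (sym eq) (proj₁ (hull r)))))

          into′ : Into
          into′ p Up≡ p≢j with <-cmp (W j) (W r₀)
          ... | tri< Wj<x _ _ = west Wj<x p Up≡ p≢j
          ... | tri≈ _ eq _ = ⊥-elim (Wj≢x eq)
          ... | tri> _ _ x<Wj =
            (λ _ Up<t _ → <-irrefl refl (<-trans r<j (east j x<Wj
              (NE-mono ≤-refl (<⇒≤ (subst (F._< U r) Up≡ Up<t)) (proj₁ (hull r)))))) ,
            below
            where
            below : j F.< p → U r F.< U p → ¬ SW p (U r)
            -- If `W l` is at or west of `W r₀`, then `l` permits the step from `p` to `j` in `u`;
            -- otherwise `east` puts `l` above row `r`, although it lies below `j`.
            below j<p t<Up (l , p≤l , Wl≤t) with W l F.≤? W r₀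
            ... | yes Wl≤x = proj₂ (stuck p j Up≡) j<p
                    (subst (F._< U p) (sym Uj≡) (<-trans x<t t<Up))
                    (l , p≤l , subst (W l F.≤_) (sym Uj≡) Wl≤x)
            ... | no ¬le = <-irrefl refl (<-trans (<-trans r<j j<p)
                    (≤-<-trans p≤l (east l (≰⇒> ¬le) (NE-mono ≤-refl Wl≤t (proj₁ (hull r))))))

          out′ : Out
          out′ q t≡ q≢j =
            (λ j<q _ _ → <-irrefl refl (<-trans q<r (<-trans r<j j<q))) ,
            (λ _ Uq<t sw → proj₂ (stuck r q t≡) q<r Uq<t (SW-mono (<⇒≤ r<j) ≤-refl sw))
            where
            q<r : q F.< r
            q<r = east q (subst (W r₀ F.<_) t≡ x<t) (subst (NE r) t≡ (proj₁ (hull r)))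

-- Stuck permutations and short paths inside the hull

module _ {n} (w : Perm n) where
  open Hull w

  module _ (noRect : NoRectangle) where

    -- Redirecting keeps u in the hull and stuck while fixing one more row, so a stuck
    -- permutation other than w would give an infinite descent.
    stuck-fixed : ∀ u → Acc _<_ (moved u) → InHull u → Stuck u → ∀ k → ¬ (u ⟨$⟩ʳ k ≢ W k)
    stuck-fixed u (acc rec) hull stuck k = first-moved k (FinInd.<-wellFounded k)
      where
      U = u ⟨$⟩ʳ_

      U-injective : ∀ {i j} → U i ≡ U j → i ≡ j
      U-injective = perm-injective u

      -- The descent: `u′` has fewer moved rows, so the recursive call says that it moves none, yet
      -- it still moves `j`.
      absurd : ∀ {j r} (u′ : Perm n) → Redirect u j r → u′ ⟨$⟩ʳ j ≡ U r → u′ ⟨$⟩ʳ r ≡ W r →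
               (∀ i → i ≢ j → u′ ⟨$⟩ʳ i ≡ W i ⊎ u′ ⟨$⟩ʳ i ≡ U i) → ⊥
      absurd {j} u′ red u′j u′r rest =
        stuck-fixed u′ (rec (redirect-moved u u′ red u′j u′r rest))
          (redirect-inHull u u′ red u′j u′r rest hull)
          (redirect-stuck u u′ red u′j u′r rest stuck)
          j (redirect-j-moved u u′ red u′j u′r rest)

      swap-rest : ∀ {j r} → U j ≡ W r → ∀ i → i ≢ j →
                  U (swap j r i) ≡ W i ⊎ U (swap j r i) ≡ U i
      swap-rest {j} {r} Uj≡ i i≢j with swapView j r i
      ... | at-left i≡j _ = ⊥-elim (i≢j i≡j)
      ... | at-right refl eq = inj₁ (trans (cong U eq) Uj≡)
      ... | outside _ _ eq = inj₂ (cong U eq)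

      -- The degenerate corner, where `(k , W k)` is itself a point of `w` and plays both `r` and
      -- `r₀`.
      no-up-right : ∀ j k → U j ≡ W k → k F.< j → U j F.< U k → ⊥
      no-up-right j k Uj≡ k<j up = absurd (transpose j k · u)
        (corner-redirect noRect u hull stuck ≤-refl ≤-refl k<j Uj≡ (subst (F._< U k) Uj≡ up))
        (cong U (swapˡ j k)) (trans (cong U (swapʳ j k)) Uj≡) (swap-rest Uj≡)

      first-moved : ∀ k → Acc F._<_ k → ¬ (U k ≢ W k)
      first-moved k (acc earlier) k-moved = turn (<-cmp (U l) (U k))
        where
        fixed : ∀ i → i F.< k → U i ≡ W i
        fixed i i<k = decidable-stable (U i ≟ W i) (first-moved i (earlier i<k))

        -- The neighbours of `k` in its cycle, which runs from `j` to `k` to `l`. Both lie below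
        -- `k`, since all earlier rows are fixed.
        j l : Fin n
        j = u ⟨$⟩ˡ W k
        l = w ⟨$⟩ˡ U k

        Uj≡ : U j ≡ W k
        Uj≡ = inverseʳ u

        Wl≡ : W l ≡ U k
        Wl≡ = inverseʳ w

        k<j : k F.< j
        k<j with <-cmp j k
        ... | tri< j<k _ _ = ⊥-elim (<⇒≢ j<k (W-injective (trans (sym (fixed j j<k)) Uj≡)))
        ... | tri≈ _ j≡k _ = ⊥-elim (k-moved (trans (cong U (sym j≡k)) Uj≡))
        ... | tri> _ _ k<j = k<j

        k<l : k F.< l
        k<l with <-cmp l k
        ... | tri< l<k _ _ = ⊥-elim (<⇒≢ l<k (U-injective (trans (fixed l l<k) Wl≡)))
        ... | tri≈ _ l≡k _ = ⊥-elim (k-moved (trans (sym Wl≡) (cong W l≡k)))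
        ... | tri> _ _ k<l = k<l

        Uk<Uj : U k F.< U j
        Uk<Uj with <-cmp (U k) (U j)
        ... | tri< lt _ _ = lt
        ... | tri≈ _ eq _ = ⊥-elim (<⇒≢ k<j (U-injective eq))
        ... | tri> _ _ gt = ⊥-elim (no-up-right j k Uj≡ k<j gt)

        Uk<Wk : U k F.< W k
        Uk<Wk = subst (U k F.<_) Uj≡ Uk<Uj

        ¬sw : ¬ SW j (U k)
        ¬sw = proj₂ (stuck j k Uj≡) k<j Uk<Uj

        turn : _ → ⊥
        turn (tri≈ _ eq _) = <⇒≢ k<l (sym (U-injective eq))
        -- The path goes on to the west in row `l`: this row is cut out, and row `k` takes `U l`
        -- directly.
        turn (tri< Ul<Uk _ _) = absurd (transpose k l · u) (record
            { cell    = NE-mono ≤-refl (<⇒≤ Ul<Uk) (proj₁ (hull k)) ,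
                        SW-mono (<⇒≤ k<l) ≤-refl (proj₂ (hull l))
            ; W≢      = λ eq → <-irrefl (cong toℕ (sym eq)) (<-trans Ul<Uk Uk<Wk)
            ; j-moved = k-moved
            ; r-moved = Ul≢Wl
            ; into    = into
            ; out     = out
            }) (cong U (swapˡ k l)) (trans (cong U (swapʳ k l)) (sym Wl≡)) (swap-rest (sym Wl≡))
          where
          Ul≢Wl : U l ≢ W l
          Ul≢Wl eq = <-irrefl (cong toℕ (trans eq Wl≡)) Ul<Uk

          into : ∀ p → U p ≡ W k → p ≢ k →
                 (p F.< k → U p F.< U l → ¬ NE p (U l)) × (k F.< p → U l F.< U p → ¬ SW p (U l))
          into p Up≡ _ with U-injective (trans Up≡ (sym Uj≡))
          ... | refl = (λ j<k → ⊥-elim (<-irrefl refl (<-trans j<k k<j))) ,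
                       (λ _ _ sw → ¬sw (SW-mono ≤-refl (<⇒≤ Ul<Uk) sw))

          out : ∀ q → U l ≡ W q → q ≢ k →
                (k F.< q → U l F.< U q → ¬ NE k (U q)) × (q F.< k → U q F.< U l → ¬ SW k (U q))
          out q Ul≡ _ = right ,
            (λ q<k → ⊥-elim (<⇒≢ (<-trans q<k k<l) (U-injective (trans (fixed q q<k) (sym Ul≡)))))
            where
            right : k F.< q → U l F.< U q → ¬ NE k (U q)
            right k<q Ul<Uq ne with <-cmp q l
            ... | tri< q<l _ _ = no-up-right l q Ul≡ q<l Ul<Uq
            ... | tri≈ _ refl _ = Ul≢Wl Ul≡
            ... | tri> _ _ l<q = proj₁ (stuck l q Ul≡) l<q Ul<Uq (NE-mono (<⇒≤ k<l) ≤-refl ne)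
        -- The path goes back to the east in row `l`, beyond column `W k`. The turn is cut off at
        -- the corner `(l , W k)`: row `j` takes `U l`, and `k` and `l` both become fixed.
        turn (tri> _ _ Uk<Ul) = absurd (transpose j l · (transpose j k · u))
            (corner-redirect noRect u hull stuck (<⇒≤ k<l)
              (<⇒≤ (subst (F._< W k) (sym Wl≡) Uk<Wk)) l<j Uj≡ Wk<Ul)
            (trans (cong (λ p → U (swap j k p)) (swapˡ j l)) (cong U (swap-≢ l≢j l≢k)))
            (trans (cong (λ p → U (swap j k p)) (swapʳ j l)) (trans (cong U (swapˡ j k)) (sym Wl≡)))
            rest
          where
          l<j : l F.< j
          l<j with j F.≤? l
          ... | yes j≤l = ⊥-elim (¬sw (l , j≤l , ℕ.≤-reflexive (cong toℕ Wl≡)))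
          ... | no j≰l = ≰⇒> j≰l

          Wk<Ul : W k F.< U l
          Wk<Ul with U l F.≤? W k
          ... | yes Ul≤Wk = ⊥-elim (proj₁ (stuck k l (sym Wl≡)) k<l Uk<Ul (k , ≤-refl , Ul≤Wk))
          ... | no Ul≰Wk = ≰⇒> Ul≰Wk

          l≢j = <⇒≢ l<j
          l≢k : l ≢ k
          l≢k e = <⇒≢ k<l (sym e)

          rest : ∀ i → i ≢ j → U (swap j k (swap j l i)) ≡ W i ⊎ U (swap j k (swap j l i)) ≡ U i
          rest i i≢j with swapView j l i
          ... | at-left i≡j _ = ⊥-elim (i≢j i≡j)
          ... | at-right refl eq = inj₁ (trans (cong (λ p → U (swap j k p)) eq)
                                    (trans (cong U (swapˡ j k)) (sym Wl≡)))
          ... | outside _ _ eq rewrite eq = swap-rest Uj≡ i i≢j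

    GoodStep : Perm n → Fin n → Fin n → Set
    GoodStep u i j = u ⟨$⟩ʳ i ≡ W j ×
      ((i F.< j × (u ⟨$⟩ʳ i) F.< (u ⟨$⟩ʳ j) × NE i (u ⟨$⟩ʳ j)) ⊎
       (j F.< i × (u ⟨$⟩ʳ j) F.< (u ⟨$⟩ʳ i) × SW i (u ⟨$⟩ʳ j)))

    goodStep : ∀ u → InHull u → ¬ (u ≈ w) → ∃[ i ] ∃[ j ] GoodStep u i j
    goodStep u hull u≉w with any? (λ i → any? (good? i))
      where
      good? : ∀ i j → Dec (GoodStep u i j)
      good? i j = ((u ⟨$⟩ʳ i) ≟ W j) ×-dec
        (((i F.<? j) ×-dec (((u ⟨$⟩ʳ i) F.<? (u ⟨$⟩ʳ j)) ×-dec NE? i (u ⟨$⟩ʳ j))) ⊎-dec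
         ((j F.<? i) ×-dec (((u ⟨$⟩ʳ j) F.<? (u ⟨$⟩ʳ i)) ×-dec SW? i (u ⟨$⟩ʳ j))))
    ... | yes good = good
    ... | no ¬good = ⊥-elim (u≉w λ k → decidable-stable ((u ⟨$⟩ʳ k) ≟ W k)
            (stuck-fixed u (<-wellFounded (moved u)) hull
              (λ i j eq → (λ i<j up ne → ¬good (i , j , eq , inj₁ (i<j , up , ne))) ,
                          (λ j<i up sw → ¬good (i , j , eq , inj₂ (j<i , up , sw)))) k))

    goodStep-ascent : ∀ {u i j} → GoodStep u i j → Ascent u (transpose i j · u)
    goodStep-ascent (_ , inj₁ (i<j , up , _)) = ascent i<j up (λ _ → refl)
    goodStep-ascent {u} {i} {j} (_ , inj₂ (j<i , up , _)) =
      ascent j<i up (λ p → cong (u ⟨$⟩ʳ_) (swap-comm i j p))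

    goodStep-inHull : ∀ {u i j} → GoodStep u i j → InHull u → InHull (transpose i j · u)
    goodStep-inHull {u} {i} {j} (eq , dir) hull p with swapView i j p
    ... | at-right refl τ rewrite τ | eq = (p , ≤-refl , ≤-refl) , (p , ≤-refl , ≤-refl)
    ... | outside _ _ τ rewrite τ = hull p
    goodStep-inHull (_ , inj₁ (_ , up , ne)) hull p | at-left refl τ
      rewrite τ = ne , SW-mono ≤-refl (<⇒≤ up) (proj₂ (hull p))
    goodStep-inHull (_ , inj₂ (_ , up , sw)) hull p | at-left refl τ
      rewrite τ = NE-mono ≤-refl (<⇒≤ up) (proj₁ (hull p)) , sw

    -- Each good step spends one factor of the given factorization by `bypass`, so the number of
    -- factors bounds the path and drives the recursion.
    hull-path : ∀ k u → InHull u → ProdOfTrans (u · w ⁻¹) k → ∃[ m ] m ≤ k × Path u w m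
    hull-path k u hull pr with all? (λ i → (u ⟨$⟩ʳ i) ≟ W i)
    ... | yes u≈w = 0 , z≤n , stop u≈w
    ... | no u≉w with goodStep u hull u≉w
    ...   | i , j , good with bypass {v = u · w ⁻¹} i≢j (trans (cong (w ⟨$⟩ˡ_) (proj₁ good)) (inverseˡ w)) pr
      where
      i≢j : i ≢ j
      i≢j refl with proj₂ good
      ... | inj₁ (i<i , _) = <-irrefl refl i<i
      ... | inj₂ (i<i , _) = <-irrefl refl i<i
    ...     | k′ , refl , pr′ with hull-path k′ (transpose i j · u) (goodStep-inHull {u} good hull)
                                     (prodOfTrans-≈ {v = transpose i j · (u · w ⁻¹)}
                                       {v′ = (transpose i j · u) · w ⁻¹} (λ _ → refl) pr′)
    ...       | m , m≤k′ , path = suc m , s≤s m≤k′ ,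
      step (ascent⇒edge {x = u} {y = transpose i j · u} (goodStep-ascent {u} good)) path

  -- The points of `y` in rows `a` and `b` are the north-east and south-west corners of a rectangle
  -- whose other corners are the points of `u`, so the witnesses for the former serve the latter.
  path⇒inHull : ∀ {u k} → Path u w k → InHull u
  path⇒inHull (stop u≈w) i rewrite u≈w i = (i , ≤-refl , ≤-refl) , (i , ≤-refl , ≤-refl)
  path⇒inHull {u} (step {y = y} e path) with edge⇒ascent {x = u} {y} e
  ... | ascent {a} {b} a<b up y≈ = λ p → in-hull p (swapView a b p)
    where
    hull = path⇒inHull path
    ya = trans (y≈ a) (cong (u ⟨$⟩ʳ_) (swapˡ a b))
    yb = trans (y≈ b) (cong (u ⟨$⟩ʳ_) (swapʳ a b))

    neₐ : NE a (u ⟨$⟩ʳ b)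
    neₐ = subst (NE a) ya (proj₁ (hull a))

    sw_b : SW b (u ⟨$⟩ʳ a)
    sw_b = subst (SW b) yb (proj₂ (hull b))

    in-hull : ∀ p → SwapView a b p → NE p (u ⟨$⟩ʳ p) × SW p (u ⟨$⟩ʳ p)
    in-hull p (at-left refl _) = NE-mono ≤-refl (<⇒≤ up) neₐ , SW-mono (<⇒≤ a<b) ≤-refl sw_b
    in-hull p (at-right refl _) = NE-mono (<⇒≤ a<b) ≤-refl neₐ , SW-mono ≤-refl (<⇒≤ up) sw_b
    in-hull p (outside _ _ eq) =
      subst (λ y → NE p y × SW p y) (trans (y≈ p) (cong (u ⟨$⟩ʳ_) eq)) (hull p)

-- Pattern occurrences

-- With `rank`, the pattern counted from 0, only the inequalities between consecutive rows and
-- between consecutive values have to be supplied.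
occurrence : ∀ {m} {p : Vec ℕ m} (w : Perm n) (rows : Vec (Fin n) m) (values : Vec (Fin n) m)
  (rank : Vec (Fin m) m) → Vec.map (λ r → suc (toℕ r)) rank ≡ p →
  Vec.map (w ⟨$⟩ʳ_) rows ≡ Vec.map (lookup values) rank →
  Linked F._<_ rows → Linked F._<_ values → Occurs p w
occurrence {m = m} w rows values rank refl W-rows rows-sorted values-sorted =
  lookup rows , (λ a b a<b → Linked.lookup⁺ <-trans rows-sorted a<b) ,
  λ a b → mk⇔ (λ lt → subst₂ _<_ (sym (p≡ a)) (sym (p≡ b)) (s≤s (rank-reflects a b lt)))
              (λ lt → subst₂ F._<_ (sym (value a)) (sym (value b))
                (rank-mono a b (ℕ.≤-pred (subst₂ _<_ (p≡ a) (p≡ b) lt))))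
  where
  ρ : Fin m → Fin m
  ρ = lookup rank

  p≡ : ∀ a → lookup (Vec.map (λ r → suc (toℕ r)) rank) a ≡ suc (toℕ (ρ a))
  p≡ a = lookup-map a _ rank

  value : ∀ a → w ⟨$⟩ʳ lookup rows a ≡ lookup values (ρ a)
  value a = trans (sym (lookup-map a _ rows)) (trans (cong (λ v → lookup v a) W-rows) (lookup-map a _ rank))

  rank-mono : ∀ a b → ρ a F.< ρ b → lookup values (ρ a) F.< lookup values (ρ b)
  rank-mono a b = Linked.lookup⁺ <-trans values-sorted

  rank-reflects : ∀ a b → (w ⟨$⟩ʳ lookup rows a) F.< (w ⟨$⟩ʳ lookup rows b) → ρ a F.< ρ b
  rank-reflects a b lt with <-cmp (ρ a) (ρ b)
  ... | tri< ρ< _ _ = ρ<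
  ... | tri≈ _ eq _ = ⊥-elim (<-irrefl
          (cong toℕ (trans (value a) (trans (cong (lookup values) eq) (sym (value b))))) lt)
  ... | tri> _ _ ρ> = ⊥-elim (<-irrefl refl (<-trans lt
          (subst₂ F._<_ (sym (value b)) (sym (value a)) (rank-mono b a ρ>))))

-- In each of the two corners of the rectangle either one point of w suffices or two
-- points are needed; the four combinations give the four patterns.
noRectangle : (w : Perm n) → Avoids w p4231 → Avoids w p35142 → Avoids w p42513 → Avoids w p351624 →
              Hull.NoRectangle w
noRectangle {n} w ¬4231 ¬35142 ¬42513 ¬351624 r r₀ s s₀ r₀≤r Wr≤x s≤s₀ z≤Ws r<s x<z
    (k , k≤r , z≤Wk) (l , s≤l , Wl≤x) =
  contradict northWest southEast
  where
  open Hull w using (W; W-injective)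

  ≢-row : ∀ {a b} → W a F.< W b → a ≢ b
  ≢-row lt refl = <-irrefl refl lt

  k<r : k F.< r
  k<r = ≤∧≢⇒< k≤r (λ e → ≢-row (≤-<-trans Wr≤x (<-≤-trans x<z z≤Wk)) (sym e))

  s<l : s F.< l
  s<l = ≤∧≢⇒< s≤l (λ e → ≢-row (≤-<-trans Wl≤x (<-≤-trans x<z z≤Ws)) (sym e))

  z<Wk : W s₀ F.< W k
  z<Wk = ≤∧≢⇒< z≤Wk (λ e → <⇒≢ (<-≤-trans (<-trans k<r r<s) s≤s₀) (sym (W-injective e)))

  Wl<x : W l F.< W r₀
  Wl<x = ≤∧≢⇒< Wl≤x (λ e → <⇒≢ (≤-<-trans r₀≤r (<-trans r<s s<l)) (sym (W-injective e)))

  NorthWest SouthEast : Set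
  NorthWest = (∃[ a ] k F.< a × a F.≤ r × W l F.< W a × W a F.≤ W r₀) ⊎ (r₀ F.< k × W r F.< W l)
  SouthEast = (∃[ b ] s F.≤ b × b F.< l × W s₀ F.≤ W b × W b F.< W k) ⊎ (W k F.< W s × l F.< s₀)

  -- `r₀` can play the 2 of `p4231` if it comes after `k`, and `r` can if it lies east of `l`.
  -- Otherwise both enter the pattern, one on each side of `k`.
  northWest : NorthWest
  northWest with <-cmp k r₀ | <-cmp (W l) (W r)
  ... | tri< k<r₀ _ _ | _ = inj₁ (r₀ , k<r₀ , r₀≤r , Wl<x , ≤-refl)
  ... | tri≈ _ refl _ | _ = ⊥-elim (<-irrefl refl (<-≤-trans x<z z≤Wk))
  ... | tri> _ _ r₀<k | tri< Wl<Wr _ _ = inj₁ (r , k<r , ≤-refl , Wl<Wr , Wr≤x)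
  ... | tri> _ _ r₀<k | tri≈ _ eq _ = ⊥-elim (<⇒≢ (<-trans r<s s<l) (sym (W-injective eq)))
  ... | tri> _ _ r₀<k | tri> _ _ Wr<Wl = inj₂ (r₀<k , Wr<Wl)

  southEast : SouthEast
  southEast with <-cmp (W k) (W s) | <-cmp l s₀
  ... | tri> _ _ Ws<Wk | _ = inj₁ (s , ≤-refl , s<l , z≤Ws , Ws<Wk)
  ... | tri≈ _ eq _ | _ = ⊥-elim (<⇒≢ (<-trans k<r r<s) (W-injective eq))
  ... | tri< Wk<Ws _ _ | tri> _ _ s₀<l = inj₁ (s₀ , s≤s₀ , s₀<l , ≤-refl , z<Wk)
  ... | tri< Wk<Ws _ _ | tri≈ _ refl _ = ⊥-elim (<-irrefl refl (<-≤-trans x<z Wl≤x))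
  ... | tri< Wk<Ws _ _ | tri< l<s₀ _ _ = inj₂ (Wk<Ws , l<s₀)

  contradict : NorthWest → SouthEast → ⊥
  contradict (inj₁ (a , k<a , a≤r , Wl<Wa , Wa≤x)) (inj₁ (b , s≤b , b<l , z≤Wb , Wb<Wk)) =
    ¬4231 (occurrence w (k ∷ a ∷ b ∷ l ∷ []) (W l ∷ W a ∷ W b ∷ W k ∷ [])
      (# 3 ∷ # 1 ∷ # 2 ∷ # 0 ∷ []) refl refl
      (k<a ∷ ≤-<-trans a≤r (<-≤-trans r<s s≤b) ∷ b<l ∷ [-])
      (Wl<Wa ∷ ≤-<-trans Wa≤x (<-≤-trans x<z z≤Wb) ∷ Wb<Wk ∷ [-]))
  contradict (inj₂ (r₀<k , Wr<Wl)) (inj₁ (b , s≤b , b<l , z≤Wb , Wb<Wk)) =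
    ¬35142 (occurrence w (r₀ ∷ k ∷ r ∷ b ∷ l ∷ []) (W r ∷ W l ∷ W r₀ ∷ W b ∷ W k ∷ [])
      (# 2 ∷ # 4 ∷ # 0 ∷ # 3 ∷ # 1 ∷ []) refl refl
      (r₀<k ∷ k<r ∷ <-≤-trans r<s s≤b ∷ b<l ∷ [-])
      (Wr<Wl ∷ Wl<x ∷ <-≤-trans x<z z≤Wb ∷ Wb<Wk ∷ [-]))
  contradict (inj₁ (a , k<a , a≤r , Wl<Wa , Wa≤x)) (inj₂ (Wk<Ws , l<s₀)) =
    ¬42513 (occurrence w (k ∷ a ∷ s ∷ l ∷ s₀ ∷ []) (W l ∷ W a ∷ W s₀ ∷ W k ∷ W s ∷ [])
      (# 3 ∷ # 1 ∷ # 4 ∷ # 0 ∷ # 2 ∷ []) refl refl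
      (k<a ∷ ≤-<-trans a≤r r<s ∷ s<l ∷ l<s₀ ∷ [-])
      (Wl<Wa ∷ ≤-<-trans Wa≤x x<z ∷ z<Wk ∷ Wk<Ws ∷ [-]))
  contradict (inj₂ (r₀<k , Wr<Wl)) (inj₂ (Wk<Ws , l<s₀)) =
    ¬351624 (occurrence w (r₀ ∷ k ∷ r ∷ s ∷ l ∷ s₀ ∷ []) (W r ∷ W l ∷ W r₀ ∷ W s₀ ∷ W k ∷ W s ∷ [])
      (# 2 ∷ # 4 ∷ # 0 ∷ # 5 ∷ # 1 ∷ # 3 ∷ []) refl refl
      (r₀<k ∷ k<r ∷ r<s ∷ s<l ∷ l<s₀ ∷ [-])
      (Wr<Wl ∷ Wl<x ∷ x<z ∷ z<Wk ∷ Wk<Ws ∷ [-]))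

-- Short paths

-- The double negation makes this constructive for an arbitrary `P`, and it suffices where the goal
-- is `⊥`.
¬¬-minimum : ∀ {P : ℕ → Set} k → P k → ¬ ¬ (∃[ j ] P j × (∀ m → P m → j ≤ m))
¬¬-minimum {P} k Pk none = go k (<-wellFounded k) Pk
  where
  go : ∀ k → Acc _<_ k → ¬ P k
  go k (acc rec) Pk = none (k , Pk , λ m Pm → ≮⇒≥ (λ m<k → go m (rec m<k) Pm))

Agreement : Perm n → Set
Agreement w = ∀ u → u <B w → ∀ k j → AbsLength (u · w ⁻¹) k → AbsLengthPath u w j → k ≡ j

module _ {n} (w : Perm n) (C : Fin n → Set) (d₁ d₂ : Fin n) (¬Cd₁ : ¬ C d₁) (¬Cd₂ : ¬ C d₂) where
  open Hull w using (W)

  -- The invariant along a path of length `ℓ'`: one step may undo the exchange of `d₁` and `d₂`, and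
  -- no other step touches these two rows.
  Exchanged Layout : Perm n → Set
  Exchanged x = x ⟨$⟩ʳ d₁ ≡ W d₂ × x ⟨$⟩ʳ d₂ ≡ W d₁
  Layout x = (∀ i → C i ⊎ i ≡ d₁ ⊎ i ≡ d₂ ⊎ x ⟨$⟩ʳ i ≡ W i) ×
             (Exchanged x ⊎ (x ⟨$⟩ʳ d₁ ≡ W d₁ × x ⟨$⟩ʳ d₂ ≡ W d₂))

  IsAbsBound : Perm n → ℕ → Set
  IsAbsBound x k = ∀ m → ProdOfTrans (x · w ⁻¹) m → k ≤ m

  module _ (x y : Perm n) {m} (path : Path y w m) (bound : IsAbsBound x (suc m)) where

    -- Otherwise the step inserts the fixed row `a` into the cycle of `b`. Taking it out again by
    -- `bypass` leaves one factor fewer than `path` has, against the bound for `x`.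
    geodesic-avoids-fixed : ∀ {a b} → a ≢ b → y ≈ transpose a b · x → x ⟨$⟩ʳ a ≢ W a
    geodesic-avoids-fixed {a} {b} a≢b y≈ xa≡
      with bypass {v = y · w ⁻¹} (λ e → a≢b (sym e))
             (trans (cong (w ⟨$⟩ˡ_) (trans (y≈ b) (trans (cong (x ⟨$⟩ʳ_) (swapʳ a b)) xa≡))) (inverseˡ w))
             (path⇒prodOfTrans path)
    ... | k , refl , pr = <-irrefl refl (≤-trans (ℕ.m≤n+m (suc k) 1)
      (bound k (prodOfTrans-≈ {v = transpose b a · (y · w ⁻¹)} {v′ = x · w ⁻¹}
        (λ p → cong (w ⟨$⟩ˡ_) (trans (y≈ _) (cong (x ⟨$⟩ʳ_)
          (trans (cong (swap a b) (swap-comm b a p)) (swap-involutive a b p))))) pr)))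

    -- With any other `b` the step merges two cycles, and `y · w ⁻¹` runs from `b` to `d` to `a`.
    -- Two bypasses save two factors and restoring `(a d)` costs one, which is too few for the
    -- bound.
    geodesic-keeps-2-cycle : ∀ {a b d} → a ≢ b → y ≈ transpose a b · x → x ⟨$⟩ʳ a ≡ W d →
                             x ⟨$⟩ʳ d ≡ W a → a ≢ d → b ≡ d
    geodesic-keeps-2-cycle {a} {b} {d} a≢b y≈ xa≡ xd≡ a≢d with b ≟ d
    ... | yes b≡d = b≡d
    ... | no b≢d with bypass {v = V} b≢d Vb (path⇒prodOfTrans path)
      where
      V = y · w ⁻¹
      Vb : V ⟨$⟩ʳ b ≡ d
      Vb = trans (cong (w ⟨$⟩ˡ_) (trans (y≈ b) (trans (cong (x ⟨$⟩ʳ_) (swapʳ a b)) xa≡))) (inverseˡ w)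
    ...   | k₁ , refl , pr₁ with bypass {v = V₁} (λ e → a≢b (sym e)) V₁b pr₁
      where
      V₁ = transpose b d · (y · w ⁻¹)
      V₁b : V₁ ⟨$⟩ʳ b ≡ a
      V₁b = trans (cong (λ p → w ⟨$⟩ˡ (y ⟨$⟩ʳ p)) (swapˡ b d))
              (trans (cong (w ⟨$⟩ˡ_) (trans (y≈ d) (trans
                (cong (x ⟨$⟩ʳ_) (swap-≢ (λ e → a≢d (sym e)) (λ e → b≢d (sym e)))) xd≡))) (inverseˡ w))
    ...     | k₂ , refl , pr₂ = ⊥-elim (<-irrefl refl (≤-trans (ℕ.m≤n+m (suc (suc k₂)) 1)
      (bound (suc k₂) (prodOfTrans-cons {v = transpose b a · (transpose b d · (y · w ⁻¹))} {v′ = x · w ⁻¹}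
        a≢d (λ p → cong (w ⟨$⟩ˡ_) (sym (begin
          y ⟨$⟩ʳ swap b d (swap b a (swap a d p))
            ≡⟨ cong (λ q → y ⟨$⟩ʳ swap b d q) (swap-conj (swap b a) (swap-injective b a) a d p) ⟩
          y ⟨$⟩ʳ swap b d (swap (swap b a a) (swap b a d) (swap b a p))
            ≡⟨ cong₂ (λ q q′ → y ⟨$⟩ʳ swap b d (swap q q′ (swap b a p)))
              (swapʳ b a) (swap-≢ (λ e → b≢d (sym e)) (λ e → a≢d (sym e))) ⟩
          y ⟨$⟩ʳ swap b d (swap b d (swap b a p))            ≡⟨ cong (y ⟨$⟩ʳ_) (swap-involutive b d _) ⟩
          y ⟨$⟩ʳ swap b a p                                  ≡⟨ y≈ _ ⟩
          x ⟨$⟩ʳ swap a b (swap b a p)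
            ≡⟨ cong (x ⟨$⟩ʳ_) (trans (cong (swap a b) (swap-comm b a p)) (swap-involutive a b p)) ⟩
          x ⟨$⟩ʳ p                                           ∎))) pr₂))))
      where open ≡-Reasoning

    geodesic-endpoint : Layout x → ∀ {a b} → a ≢ b → y ≈ transpose a b · x →
      C a ⊎ (Exchanged x × ((a ≡ d₁ × b ≡ d₂) ⊎ (a ≡ d₂ × b ≡ d₁)))
    geodesic-endpoint (cover , ds) {a} {b} a≢b y≈ with cover a
    ... | inj₁ Ca = inj₁ Ca
    ... | inj₂ (inj₂ (inj₂ fix)) = ⊥-elim (geodesic-avoids-fixed a≢b y≈ fix)
    geodesic-endpoint (cover , inj₂ (fix₁ , fix₂)) {a} {b} a≢b y≈ | inj₂ (inj₁ refl) =
      ⊥-elim (geodesic-avoids-fixed a≢b y≈ fix₁)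
    geodesic-endpoint (cover , inj₂ (fix₁ , fix₂)) {a} {b} a≢b y≈ | inj₂ (inj₂ (inj₁ refl)) =
      ⊥-elim (geodesic-avoids-fixed a≢b y≈ fix₂)
    geodesic-endpoint (cover , inj₁ ex@(x₁ , x₂)) {a} {b} a≢b y≈ | inj₂ (inj₁ refl) with d₁ ≟ d₂
    -- When `d₁` and `d₂` coincide, being exchanged means being fixed.
    ... | yes refl = ⊥-elim (geodesic-avoids-fixed a≢b y≈ x₁)
    ... | no d₁≢d₂ = inj₂ (ex , inj₁ (refl , geodesic-keeps-2-cycle a≢b y≈ x₁ x₂ d₁≢d₂))
    geodesic-endpoint (cover , inj₁ ex@(x₁ , x₂)) {a} {b} a≢b y≈ | inj₂ (inj₂ (inj₁ refl)) with d₂ ≟ d₁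
    ... | yes refl = ⊥-elim (geodesic-avoids-fixed a≢b y≈ x₁)
    ... | no d₂≢d₁ = inj₂ (ex , inj₂ (refl , geodesic-keeps-2-cycle a≢b y≈ x₂ x₁ d₂≢d₁))

  -- A path whose length is the absolute length only transposes rows within a cycle of
  -- x w⁻¹, so x already lies weakly below w as far as the rows in C are concerned.
  geodesic-dominated : ∀ {x m} → Path x w m → IsAbsBound x m → Layout x →
                       ∀ i → C i → ∃[ k ] C k × k F.≤ i × (x ⟨$⟩ʳ i) F.≤ W k
  geodesic-dominated (stop x≈w) _ _ i Ci = i , Ci , ≤-refl , ℕ.≤-reflexive (cong toℕ (x≈w i))
  geodesic-dominated {x} (step {y = y} e path) bound lay@(cover , ds) i Ci
    with edge⇒ascent {x = x} {y} e
  ... | ascent {a} {b} a<b up y≈ = go (swapView a b i)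
    where
    X = x ⟨$⟩ʳ_
    Y = y ⟨$⟩ʳ_

    a≢b : a ≢ b
    a≢b = <⇒≢ a<b

    Ya : Y a ≡ X b
    Ya = trans (y≈ a) (cong X (swapˡ a b))

    Yb : Y b ≡ X a
    Yb = trans (y≈ b) (cong X (swapʳ a b))

    Y-out : ∀ {p} → p ≢ a → p ≢ b → Y p ≡ X p
    Y-out p≢a p≢b = trans (y≈ _) (cong X (swap-≢ p≢a p≢b))

    Sides : Set
    Sides = (C a × C b) ⊎ (Exchanged x × ((a ≡ d₁ × b ≡ d₂) ⊎ (a ≡ d₂ × b ≡ d₁)))

    sides : Sides
    sides with geodesic-endpoint x y path bound lay a≢b y≈
             | geodesic-endpoint x y path bound lay (λ e → a≢b (sym e))
                 (λ p → trans (y≈ p) (cong X (swap-comm a b p)))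
    ... | inj₁ Ca | inj₁ Cb = inj₁ (Ca , Cb)
    ... | inj₂ d | _ = inj₂ d
    ... | inj₁ Ca | inj₂ (ex , inj₁ (b≡ , a≡)) = inj₂ (ex , inj₂ (a≡ , b≡))
    ... | inj₁ Ca | inj₂ (ex , inj₂ (b≡ , a≡)) = inj₂ (ex , inj₁ (a≡ , b≡))

    ds′ : Sides → Exchanged y ⊎ (Y d₁ ≡ W d₁ × Y d₂ ≡ W d₂)
    ds′ (inj₁ (Ca , Cb)) = [ (λ (x₁ , x₂) → inj₁ (trans Yd₁ x₁ , trans Yd₂ x₂)) ,
                             (λ (x₁ , x₂) → inj₂ (trans Yd₁ x₁ , trans Yd₂ x₂)) ]′ ds
      where
      Yd₁ : Y d₁ ≡ X d₁
      Yd₁ = Y-out (λ { refl → ¬Cd₁ Ca }) (λ { refl → ¬Cd₁ Cb })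
      Yd₂ : Y d₂ ≡ X d₂
      Yd₂ = Y-out (λ { refl → ¬Cd₂ Ca }) (λ { refl → ¬Cd₂ Cb })
    ds′ (inj₂ ((x₁ , x₂) , inj₁ (refl , refl))) = inj₂ (trans Ya x₂ , trans Yb x₁)
    ds′ (inj₂ ((x₁ , x₂) , inj₂ (refl , refl))) = inj₂ (trans Yb x₂ , trans Ya x₁)

    cover′ : Sides → ∀ p → C p ⊎ p ≡ d₁ ⊎ p ≡ d₂ ⊎ Y p ≡ W p
    cover′ sd p with cover p | swapView a b p
    ... | inj₁ Cp | _ = inj₁ Cp
    ... | inj₂ (inj₁ p≡) | _ = inj₂ (inj₁ p≡)
    ... | inj₂ (inj₂ (inj₁ p≡)) | _ = inj₂ (inj₂ (inj₁ p≡))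
    ... | inj₂ (inj₂ (inj₂ fix)) | outside p≢a p≢b _ = inj₂ (inj₂ (inj₂ (trans (Y-out p≢a p≢b) fix)))
    ... | inj₂ (inj₂ (inj₂ fix)) | at-left refl _ = [ (λ (Ca , _) → inj₁ Ca) ,
            [ (λ (a≡ , _) → inj₂ (inj₁ a≡)) , (λ (a≡ , _) → inj₂ (inj₂ (inj₁ a≡))) ]′ ∘ proj₂ ]′ sd
    ... | inj₂ (inj₂ (inj₂ fix)) | at-right refl _ = [ (λ (_ , Cb) → inj₁ Cb) ,
            [ (λ (_ , b≡) → inj₂ (inj₂ (inj₁ b≡))) , (λ (_ , b≡) → inj₂ (inj₁ b≡)) ]′ ∘ proj₂ ]′ sd

    bound′ : IsAbsBound y _
    bound′ k pr = ℕ.≤-pred (bound (suc k) (prodOfTrans-cons {v = y · w ⁻¹} {v′ = x · w ⁻¹} a≢b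
      (λ p → cong (w ⟨$⟩ˡ_) (sym (trans (y≈ _) (cong X (swap-involutive a b p))))) pr))

    later : ∀ i → C i → ∃[ k ] C k × k F.≤ i × Y i F.≤ W k
    later = geodesic-dominated path bound′ (cover′ sides , ds′ sides)

    Ca-of-Cb : C b → Sides → C a
    Ca-of-Cb Cb (inj₁ (Ca , _)) = Ca
    Ca-of-Cb Cb (inj₂ (_ , inj₁ (_ , refl))) = ⊥-elim (¬Cd₂ Cb)
    Ca-of-Cb Cb (inj₂ (_ , inj₂ (_ , refl))) = ⊥-elim (¬Cd₁ Cb)

    go : SwapView a b i → ∃[ k ] C k × k F.≤ i × X i F.≤ W k
    -- In `y` the upper row `a` holds the larger of the two values, so the row dominating it serves
    -- both `a` and `b`.
    go (at-left refl _) with later a Ci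
    ... | k , Ck , k≤ , Y≤ = k , Ck , k≤ , ≤-trans (<⇒≤ (subst (X a F.<_) (sym Ya) up)) Y≤
    go (at-right refl _) with later a (Ca-of-Cb Ci sides)
    ... | k , Ck , k≤ , Y≤ = k , Ck , ≤-trans k≤ (<⇒≤ a<b) , subst (F._≤ W k) Ya Y≤
    go (outside i≢a i≢b _) with later i Ci
    ... | k , Ck , k≤ , Y≤ = k , Ck , k≤ , subst (F._≤ W k) (Y-out i≢a i≢b) Y≤

  -- Agreement would make a shortest path exactly as long as the absolute length, and then
  -- `geodesic-dominated` contradicts the hypothesis on row `i`.
  ¬agreement : ∀ {u k i} → Path u w k → Layout u → C i →
               (∀ k → C k → k F.≤ i → W k F.< (u ⟨$⟩ʳ i)) → ¬ Agreement w
  ¬agreement {u} {k} {i} path lay Ci above agree =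
    ¬¬-minimum k path λ { (j , path-j , min-j) →
    ¬¬-minimum k (path⇒prodOfTrans path) λ { (l , pr-l , min-l) →
    geodesic j path-j (subst (IsAbsBound u)
      (agree u ((k , path) , u≉w) l j (pr-l , min-l) (path-j , min-j)) min-l) } }
    where
    u≉w : ¬ (u ≈ w)
    u≉w u≈w = <-irrefl (cong toℕ (sym (u≈w i))) (above i Ci ≤-refl)

    geodesic : ∀ j → Path u w j → ¬ IsAbsBound u j
    geodesic j path-j bound with geodesic-dominated path-j bound lay i Ci
    ... | k , Ck , k≤i , ui≤ = <-irrefl refl (<-≤-trans (above k Ck k≤i) ui≤)

-- A pattern p together with a chain of transpositions going down from it to an element
-- that exchanges the values of p in rows δ₁ and δ₂ and violates, in the row pivot, the
-- domination that a path of length ℓ' would force on the remaining rows.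
module _ {m} (p : Vec ℕ m) where

  -- Row `c` carries the value of `p` in row `σ c`; the pairs exchange the contents of two rows, the
  -- first pair acting first.
  rearrange : (Fin m → Fin m) → List (Fin m × Fin m) → Fin m → Fin m
  rearrange σ [] = σ
  rearrange σ ((a , b) ∷ ab) = rearrange (λ c → σ (swap a b c)) ab

  Descending : (Fin m → Fin m) → List (Fin m × Fin m) → Set
  Descending σ [] = ⊤
  Descending σ ((a , b) ∷ ab) =
    a F.< b × lookup p (σ b) < lookup p (σ a) × Descending (λ c → σ (swap a b c)) ab

  descending? : ∀ σ ab → Dec (Descending σ ab)
  descending? σ [] = yes tt
  descending? σ ((a , b) ∷ ab) =
    (a F.<? b) ×-dec ((lookup p (σ b) <? lookup p (σ a)) ×-dec descending? (λ c → σ (swap a b c)) ab)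

  Dominates : (Fin m → Fin m) → Fin m → Fin m → Fin m → Set
  Dominates τ δ₁ δ₂ pivot =
    ∀ c → c ≢ δ₁ × c ≢ δ₂ → c F.≤ pivot → lookup p c < lookup p (τ pivot)

  dominates? : ∀ τ δ₁ δ₂ pivot → Dec (Dominates τ δ₁ δ₂ pivot)
  dominates? τ δ₁ δ₂ pivot = all? λ c → (¬? (c ≟ δ₁) ×-dec ¬? (c ≟ δ₂)) →-dec
    ((c F.≤? pivot) →-dec (lookup p c <? lookup p (τ pivot)))

  Certificate : List (Fin m × Fin m) → (δ₁ δ₂ pivot : Fin m) → Set
  Certificate ab δ₁ δ₂ pivot =
    let τ = rearrange (λ c → c) ab in
    Descending (λ c → c) ab × (τ δ₁ ≡ δ₂ × τ δ₂ ≡ δ₁) × (pivot ≢ δ₁ × pivot ≢ δ₂) ×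
    Dominates τ δ₁ δ₂ pivot

  certificate? : ∀ ab δ₁ δ₂ pivot → Dec (Certificate ab δ₁ δ₂ pivot)
  certificate? ab δ₁ δ₂ pivot =
    let τ = rearrange (λ c → c) ab in
    descending? (λ c → c) ab ×-dec ((τ δ₁ ≟ δ₂) ×-dec (τ δ₂ ≟ δ₁)) ×-dec
    (¬? (pivot ≟ δ₁) ×-dec ¬? (pivot ≟ δ₂)) ×-dec dominates? τ δ₁ δ₂ pivot

  module _ {n} (w : Perm n) (ι : Fin m → Fin n) (ι-mono : ∀ a b → a F.< b → ι a F.< ι b)
           (ι-iff : ∀ a b → ((w ⟨$⟩ʳ ι a) F.< (w ⟨$⟩ʳ ι b)) ⇔ (lookup p a < lookup p b)) where
    open Hull w using (W)

    ι-injective : ∀ {a b} → ι a ≡ ι b → a ≡ b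
    ι-injective {a} {b} eq with <-cmp a b
    ... | tri< a<b _ _ = ⊥-elim (<⇒≢ (ι-mono a b a<b) eq)
    ... | tri≈ _ a≡b _ = a≡b
    ... | tri> _ _ b<a = ⊥-elim (<⇒≢ (ι-mono b a b<a) (sym eq))

    ι-reflects-≤ : ∀ {a b} → ι a F.≤ ι b → a F.≤ b
    ι-reflects-≤ {a} {b} le = ≮⇒≥ (λ b<a → <-irrefl refl (<-≤-trans (ι-mono b a b<a) le))

    Rearranges : (Fin m → Fin m) → Perm n → Set
    Rearranges σ x = (∀ a → x ⟨$⟩ʳ ι a ≡ W (ι (σ a))) ×
                     (∀ i → (∀ a → i ≢ ι a) → x ⟨$⟩ʳ i ≡ W i)

    -- Each pair is carried over by `ι` to rows of `w`, and the reversed descent becomes a new first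
    -- step of the path up to `w`.
    descend : ∀ σ ab → Descending σ ab → ∀ x {k} → Rearranges σ x → Path x w k →
              ∃[ u ] ∃[ l ] Path u w l × Rearranges (rearrange σ ab) u
    descend σ [] _ x re path = x , _ , path , re
    descend σ ((a , b) ∷ ab) (a<b , down , desc) x (on , off) path =
      descend (λ c → σ (swap a b c)) ab desc y (on′ , off′) (step (ascent⇒edge {x = y} {x} y↗x) path)
      where
      y : Perm _
      y = transpose (ι a) (ι b) · x

      on′ : ∀ c → y ⟨$⟩ʳ ι c ≡ W (ι (σ (swap a b c)))
      on′ c = trans (cong (x ⟨$⟩ʳ_) (sym (swap-conj ι ι-injective a b c))) (on (swap a b c))

      off′ : ∀ i → (∀ c → i ≢ ι c) → y ⟨$⟩ʳ i ≡ W i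
      off′ i i∉ = trans (cong (x ⟨$⟩ʳ_) (swap-≢ (i∉ a) (i∉ b))) (off i i∉)

      y↗x : Ascent y x
      y↗x = ascent (ι-mono a b a<b)
        (subst₂ F._<_ (sym (trans (cong (x ⟨$⟩ʳ_) (swapˡ (ι a) (ι b))) (on b)))
                      (sym (trans (cong (x ⟨$⟩ʳ_) (swapʳ (ι a) (ι b))) (on a)))
          (Equivalence.from (ι-iff (σ b) (σ a)) down))
        (λ i → cong (x ⟨$⟩ʳ_) (sym (swap-involutive (ι a) (ι b) i)))

    certificate⇒¬agreement : ∀ ab δ₁ δ₂ pivot → Certificate ab δ₁ δ₂ pivot → ¬ Agreement w
    certificate⇒¬agreement ab δ₁ δ₂ pivot
      (desc , (τδ₁ , τδ₂) , (pivot≢δ₁ , pivot≢δ₂) , dom)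
      with descend (λ c → c) ab desc w ((λ _ → refl) , (λ _ _ → refl)) (stop (λ _ → refl))
    ... | u , l , path , on , off =
      ¬agreement w C (ι δ₁) (ι δ₂)
        (λ (_ , (c≢ , _) , eq) → c≢ (sym (ι-injective eq)))
        (λ (_ , (_ , c≢) , eq) → c≢ (sym (ι-injective eq)))
        path
        (cover , inj₁ (trans (on δ₁) (cong (W ∘ ι) τδ₁) , trans (on δ₂) (cong (W ∘ ι) τδ₂)))
        (pivot , (pivot≢δ₁ , pivot≢δ₂) , refl)
        above
      where
      C : Fin _ → Set
      C i = ∃[ c ] (c ≢ δ₁ × c ≢ δ₂) × i ≡ ι c

      cover : ∀ i → C i ⊎ i ≡ ι δ₁ ⊎ i ≡ ι δ₂ ⊎ u ⟨$⟩ʳ i ≡ W i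
      cover i with any? (λ c → i ≟ ι c)
      ... | no i∉ = inj₂ (inj₂ (inj₂ (off i (λ c eq → i∉ (c , eq)))))
      ... | yes (c , eq) with c ≟ δ₁ | c ≟ δ₂
      ...   | yes refl | _ = inj₂ (inj₁ eq)
      ...   | no _ | yes refl = inj₂ (inj₂ (inj₁ eq))
      ...   | no c≢₁ | no c≢₂ = inj₁ (c , (c≢₁ , c≢₂) , eq)

      above : ∀ k → C k → k F.≤ ι pivot → W k F.< (u ⟨$⟩ʳ ι pivot)
      above k (c , c≢ , refl) k≤ = subst (W (ι c) F.<_) (sym (on pivot))
        (Equivalence.from (ι-iff c _) (dom c c≢ (ι-reflects-≤ k≤)))

-- The certificates for the four patterns and the equivalence

agreement⇒avoids : ∀ {m n} (p : Vec ℕ m) ab δ₁ δ₂ pivot {_ : True (certificate? p ab δ₁ δ₂ pivot)}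
                   (w : Perm n) → Agreement w → Avoids w p
agreement⇒avoids p ab δ₁ δ₂ pivot {cert} w agree (ι , ι-mono , ι-iff) =
  certificate⇒¬agreement p w ι ι-mono ι-iff ab δ₁ δ₂ pivot (toWitness cert) agree

theorem6p3 : ∀ {n} (w : Perm n) →
    (Avoids w p4231 × Avoids w p35142 × Avoids w p42513 × Avoids w p351624)
    ⇔ (∀ u → u <B w → ∀ k j → AbsLength (u · w ⁻¹) k → AbsLengthPath u w j → k ≡ j)
theorem6p3 w = mk⇔ avoids⇒agreement λ agree →
    -- The four chains end at 1324, 12435, 13245 and 124356. The pivot row then holds 3, 4, 3 and 4
    -- respectively, more than the pattern has in any row up to the pivot outside the exchanged
    -- pair.
    agreement⇒avoids p4231 ((# 0 , # 1) ∷ (# 0 , # 3) ∷ (# 1 , # 2) ∷ (# 2 , # 3) ∷ [])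
      (# 0) (# 3) (# 1) w agree ,
    agreement⇒avoids p35142
      ((# 0 , # 2) ∷ (# 1 , # 2) ∷ (# 1 , # 4) ∷ (# 2 , # 3) ∷ (# 3 , # 4) ∷ [])
      (# 1) (# 4) (# 2) w agree ,
    agreement⇒avoids p42513
      ((# 0 , # 1) ∷ (# 0 , # 3) ∷ (# 1 , # 4) ∷ (# 2 , # 3) ∷ (# 3 , # 4) ∷ [])
      (# 0) (# 3) (# 1) w agree ,
    agreement⇒avoids p351624
      ((# 0 , # 2) ∷ (# 1 , # 2) ∷ (# 1 , # 4) ∷ (# 2 , # 5) ∷ (# 3 , # 4) ∷ (# 4 , # 5) ∷ [])
      (# 1) (# 4) (# 2) w agree
  where
  avoids⇒agreement : Avoids w p4231 × Avoids w p35142 × Avoids w p42513 × Avoids w p351624 → Agreement w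
  avoids⇒agreement (¬4231 , ¬35142 , ¬42513 , ¬351624) u ((_ , path) , _) k j (pr , k-min) (path-j , j-min)
    with hull-path w (noRectangle w ¬4231 ¬35142 ¬42513 ¬351624) k u (path⇒inHull w path) pr
  ... | m , m≤k , path-m =
    -- A path is a factorization, so `k` is at most `j`; the path inside the hull has at most `k`
    -- steps, which gives the converse.
    ℕ.≤-antisym (k-min j (path⇒prodOfTrans path-j)) (≤-trans (j-min m path-m) m≤k)
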